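{- Let $r \ge 3$ and let $\mathcal{H}$ be a friendship $r$-hypergraph on $n \ge r+1$ vertices. Then $$|E(\mathcal{H})| \ge \frac{r+1}{r}\binom{n-1}{r-1}.$$ Moreover, equality holds if and only if $\mathcal{H}$ is universal.
   Context: An $r$-uniform hypergraph is a set of vertices together with a family of $r$-element subsets (hyperedges). For an $r$-uniform hypergraph $\mathcal{H}$ and a set of vertices $A$, a vertex $u \notin A$ is a friend of $A$ in $\mathcal{H}$ if for every $B \subseteq A$ with $|B| = r-1$, the set $B \cup \{u\}$ is a hyperedge of $\mathcal{H}$. An $r$-uniform hypergraph is a friendship $r$-hypergraph if every set of $r$ vertices has exactly one friend. An $S(r-1,r,m)$ Steiner system is an $r$-uniform hypergraph on $m$ vertices in which every set of $r-1$ vertices lies in exactly one hyperedge. Given such a Steiner system $\mathcal{S}$ on $n-1$ vertices, $U_r(\mathcal{S})$ is the $r$-uniform hypergraph on $V(\mathcal{S}) \cup \{u\}$ (with $u$ a new vertex) whose hyperedges are those of $\mathcal{S}$ together with all sets $A \cup \{u\}$ with $A \subseteq V(\mathcal{S})$, $|A| = r-1$. A friendship $r$-hypergraph $\mathcal{H}$ on $n$ vertices is called universal if $\mathcal{H} \cong U_r(\mathcal{S})$ for some $S(r-1,r,n-1)$ Steiner system $\mathcal{S}$. -}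

module Defs where

open import Data.Bool using (Bool; true; false; T)
open import Data.Nat using (ℕ; zero; suc; _∸_)
open import Data.Nat.Properties using (_≟_)
open import Data.Fin using (Fin)
open import Data.Fin.Subset using (Subset; ⁅_⁆; _∉_; _⊆_; _∪_; ∣_∣)
open import Data.Vec using (Vec; []; _∷_; tabulate; lookup)
open import Data.List using (List; _++_; map; filter; length) renaming ([] to []ₗ; _∷_ to _∷ₗ_)
open import Data.Product using (Σ; _×_; _,_)
open import Relation.Binary.PropositionalEquality using (_≡_)
open import Relation.Nullary.Decidable using (⌊_⌋; T?)
open import Function.Bundles using (_↔_; Inverse)

record Hypergraph (r n : ℕ) : Set where
  field
    edge    : Subset n → Bool
    uniform : ∀ (s : Subset n) → T (edge s) → ∣ s ∣ ≡ r
open Hypergraph public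

IsEdge : ∀ {r n} → Hypergraph r n → Subset n → Set
IsEdge H s = T (edge H s)

allSubsets : (n : ℕ) → List (Subset n)
allSubsets zero = [] ∷ₗ []ₗ
allSubsets (suc n) = map (false ∷_) (allSubsets n) ++ map (true ∷_) (allSubsets n)

numEdges : ∀ {r n} → Hypergraph r n → ℕ
numEdges {n = n} H = length (filter (λ s → T? (edge H s)) (allSubsets n))

Friend : ∀ {r n} → Hypergraph r n → Fin n → Subset n → Set
Friend {r} H u A =
  u ∉ A × (∀ (B : Subset _) → B ⊆ A → ∣ B ∣ ≡ r ∸ 1 → IsEdge H (B ∪ ⁅ u ⁆))

IsFriendship : ∀ {r n} → Hypergraph r n → Set
IsFriendship {r} {n} H =
  ∀ (A : Subset n) → ∣ A ∣ ≡ r →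
    Σ (Fin n) λ u → Friend H u A × (∀ (v : Fin n) → Friend H v A → v ≡ u)

IsSteiner : ∀ {r m} → Hypergraph r m → Set
IsSteiner {r} {m} S =
  ∀ (B : Subset m) → ∣ B ∣ ≡ r ∸ 1 →
    Σ (Subset m) λ e → (IsEdge S e × B ⊆ e)
      × (∀ (e′ : Subset m) → IsEdge S e′ → B ⊆ e′ → e′ ≡ e)

-- U_r(S): vertex set Fin (suc m), where the new vertex u is `zero` and the
-- vertices of S are embedded via `suc`.
U-edge : ∀ {r m} → Hypergraph r m → Subset (suc m) → Bool
U-edge S (false ∷ t) = edge S t
U-edge {r} S (true ∷ t) = ⌊ ∣ t ∣ ≟ r ∸ 1 ⌋

image : ∀ {n k} → (Fin n ↔ Fin k) → Subset n → Subset k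
image π s = tabulate (λ j → lookup s (Inverse.from π j))

IsoTo : ∀ {r n k} → Hypergraph r n → (Subset k → Bool) → Set
IsoTo {n = n} {k} H E =
  Σ (Fin n ↔ Fin k) λ π → ∀ (s : Subset n) → edge H s ≡ E (image π s)

-- H (on n vertices) is universal: H ≅ U_r(S) for some S(r-1,r,n-1) Steiner system S
-- (n-1 = m, and the bijection Fin n ↔ Fin (suc m) forces n = suc m)
IsUniversal : ∀ {r n} → Hypergraph r n → Set
IsUniversal {r} {n} H =
  Σ ℕ λ m → Σ (Hypergraph r m) λ S → IsSteiner S × IsoTo H (U-edge S) × suc m ≡ n

{-# OPTIONS --safe #-}
-- Call an (r+1)-set complete if all its r-subsets are edges. An edge e lies in exactly one complete set, namely e
-- together with its friend. Fix a vertex v. For an r-set A through v with friend f, the edge A - v + f lies in a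
-- unique complete set c(A). Every complete set Q equals c(A) for at most r sets A:
--   * if v ∈ Q, then A = Q - x for some x ≠ v;
--   * if v ∉ Q, then A = Q + v - x - f, where x determines f and no such f is itself one of the x: otherwise either
--     Q + v - x is a second complete set containing Q - x, or A has the two friends x and f.
-- Double counting the pairs (A, e) with e ⊆ c(A), over r-sets A through v and edges e, gives the inequality.
-- If equality holds, then for every complete Q and v ∉ Q there is w ∈ Q such that the r-subsets of Q + v through w
-- are all edges (and those through v avoiding w are not). This w depends neither on v nor on Q, hence every r-set
-- through w is an edge; the edges avoiding w then form a Steiner system, since the unique edge containing B and
-- avoiding w is B plus the friend of B + w.
module Submission where

open import Defs
open import Data.Bool using (true; false; T; if_then_else_)
import Data.Bool as Bool
open import Data.Empty as Empty using (⊥-elim)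
open import Data.Fin using (Fin; zero; suc)
open import Data.Fin.Permutation as Perm using (Permutation′; transpose)
import Data.Fin.Properties as Fin
open import Data.Fin.Subset using (Subset; inside; ⁅_⁆; _∈_; _∉_; _⊆_; _∪_; _─_; _-_; ∣_∣; ⊥)
open import Data.Fin.Subset.Properties
open import Data.List using (List; []; _∷_; _++_; map; filter; length)
open import Data.List.Membership.Propositional using () renaming (_∈_ to _∈ₗ_)
open import Data.List.Membership.Propositional.Properties using (∈-filter⁺; ∈-filter⁻; ∈-map⁺; ∈-map⁻; ∈-++⁺ˡ; ∈-++⁺ʳ)
import Data.List.Properties as List
open import Data.List.Relation.Unary.All as All using ()
open import Data.List.Relation.Unary.AllPairs as AllPairs using ()
open import Data.List.Relation.Unary.Any using (here; there)
open import Data.List.Relation.Unary.Unique.Propositional using (Unique)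
open import Data.List.Relation.Unary.Unique.Propositional.Properties using (Unique[x∷xs]⇒x∉xs; map⁺; ++⁺; filter⁺)
open import Data.Nat using (ℕ; zero; suc; _+_; _*_; _∸_; _≤_; _<_; z≤n; s≤s; s≤s⁻¹)
open import Data.Nat.Combinatorics using (_C_; nCk+nC[k+1]≡[n+1]C[k+1])
open import Data.Nat.Properties
open import Algebra.Properties.CommutativeMonoid.Sum +-0-commutativeMonoid using (sum; sum-permute; sum-cong-≗)
open import Data.Product using (∃; _×_; _,_; proj₁; proj₂)
open import Data.Sum using (_⊎_; inj₁; inj₂; [_,_]′)
open import Data.Vec as Vec using (_∷_; []; lookup)
import Data.Vec.Properties as Vec
open import Function using (_∘_; flip; id; case_of_)
open import Function.Bundles using (_⇔_; mk⇔; _↔_; Inverse)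
open import Level using (Level)
open import Relation.Binary using (DecidableEquality)
open import Relation.Binary.PropositionalEquality using (_≡_; _≢_; refl; sym; trans; cong; cong₂; subst; module ≡-Reasoning)
open import Relation.Nullary using (¬_; Dec; yes; no; contradiction; does)
open import Relation.Nullary.Decidable using (T?; _×-dec_; ¬?; fromWitness)
open import Relation.Unary using (Pred; Decidable)

private variable
  a b p : Level
  m n k : ℕ
  x y : Fin n
  s t : Subset n

-- Adding and deleting single vertices

infixl 5 _⊕_ _∖_

-- Opaque so that unification can read off s and x from s ⊕ x and s ∖ x.
opaque
  _⊕_ _∖_ : Subset n → Fin n → Subset n
  s ⊕ x = s ∪ ⁅ x ⁆
  s ∖ x = s - x

opaque
  unfolding _⊕_

  ⊕-def : (s : Subset n) (x : Fin n) → s ⊕ x ≡ s ∪ ⁅ x ⁆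
  ⊕-def s x = refl

  ⊆-⊕ : s ⊆ s ⊕ x
  ⊆-⊕ = p⊆p∪q _

  ∈-⊕ : x ∈ s ⊕ x
  ∈-⊕ {x = x} {s = s} = q⊆p∪q s ⁅ x ⁆ (x∈⁅x⁆ x)

  ∈-⊕⁻ : y ∈ s ⊕ x → y ∈ s ⊎ y ≡ x
  ∈-⊕⁻ {s = s} {x = x} y∈ with x∈p∪q⁻ s ⁅ x ⁆ y∈
  ... | inj₁ y∈s = inj₁ y∈s
  ... | inj₂ y∈x = inj₂ (x∈⁅y⁆⇒x≡y x y∈x)

  ∣⊕∣ : x ∉ s → ∣ s ⊕ x ∣ ≡ suc ∣ s ∣
  ∣⊕∣ {x = zero}  {s = true  ∷ s} x∉s = contradiction Vec.here x∉s
  ∣⊕∣ {x = zero}  {s = false ∷ s} x∉s = cong (suc ∘ ∣_∣) (∪-identityʳ s)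
  ∣⊕∣ {x = suc x} {s = true  ∷ s} x∉s = cong suc (∣⊕∣ (x∉s ∘ Vec.there))
  ∣⊕∣ {x = suc x} {s = false ∷ s} x∉s = ∣⊕∣ (x∉s ∘ Vec.there)

  ∈-∖ : y ∈ s → y ≢ x → y ∈ s ∖ x
  ∈-∖ = x∈p∧x≢y⇒x∈p-y

  ∉-∖ : x ∉ s ∖ x
  ∉-∖ {x = zero}  {s = true  ∷ s} ()
  ∉-∖ {x = zero}  {s = false ∷ s} ()
  ∉-∖ {x = suc x} {s = _ ∷ s} (Vec.there x∈) = ∉-∖ x∈

  ∖⊆ : s ∖ x ⊆ s
  ∖⊆ = p─q⊆p _ _

  ∖-comm : s ∖ x ∖ y ≡ s ∖ y ∖ x
  ∖-comm = p─x─y≡p─y─x _ _ _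

⊕-⊆ : s ⊆ t → x ∈ t → s ⊕ x ⊆ t
⊕-⊆ s⊆t x∈t y∈ with ∈-⊕⁻ y∈
... | inj₁ y∈s = s⊆t y∈s
... | inj₂ refl = x∈t

∉-⊕ : y ∉ s → y ≢ x → y ∉ s ⊕ x
∉-⊕ y∉s y≢x y∈ = [ y∉s , y≢x ]′ (∈-⊕⁻ y∈)

∈⊕-≢ : y ∈ s ⊕ x → y ≢ x → y ∈ s
∈⊕-≢ y∈ y≢x with ∈-⊕⁻ y∈
... | inj₁ y∈s = y∈s
... | inj₂ y≡x = contradiction y≡x y≢x

∈-∖⇒≢ : y ∈ s ∖ x → y ≢ x
∈-∖⇒≢ y∈ refl = ∉-∖ y∈

⊆-∖ : s ⊆ t → x ∉ s → s ⊆ t ∖ x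
⊆-∖ s⊆t x∉s y∈s = ∈-∖ (s⊆t y∈s) (λ { refl → x∉s y∈s })

∖⊕ : x ∈ s → s ∖ x ⊕ x ≡ s
∖⊕ {x = x} {s = s} x∈s = ⊆-antisym (⊕-⊆ ∖⊆ x∈s) λ {y} y∈s → case y Fin.≟ x of λ
  { (yes refl) → ∈-⊕
  ; (no y≢x)   → ⊆-⊕ (∈-∖ y∈s y≢x) }

∣∖∣ : x ∈ s → suc ∣ s ∖ x ∣ ≡ ∣ s ∣
∣∖∣ x∈s = trans (sym (∣⊕∣ ∉-∖)) (cong ∣_∣ (∖⊕ x∈s))

∣∖∣′ : x ∈ s → ∣ s ∣ ≡ suc k → ∣ s ∖ x ∣ ≡ k
∣∖∣′ x∈s eq = suc-injective (trans (∣∖∣ x∈s) eq)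

∈-─⇒∉ : ∀ (t s : Subset n) → x ∈ t ─ s → x ∉ s
∈-─⇒∉ (_ ∷ t) (true ∷ s) () Vec.here
∈-─⇒∉ (_ ∷ t) (_ ∷ s) (Vec.there p) (Vec.there q) = ∈-─⇒∉ t s p q

∣<∣⇒∃∉ : ∣ s ∣ < ∣ t ∣ → ∃ λ x → x ∈ t × x ∉ s
∣<∣⇒∃∉ {s = s} {t = t} s<t with nonempty? (t ─ s)
... | yes (x , x∈) = x , p─q⊆p t s x∈ , ∈-─⇒∉ t s x∈
... | no empty = contradiction (p⊆q⇒∣p∣≤∣q∣ t⊆s) (<⇒≱ s<t)
  where
  t⊆s : t ⊆ s
  t⊆s {x} x∈t with x ∈? s
  ... | yes x∈s = x∈s
  ... | no  x∉s = contradiction (x , x∈p∧x∉q⇒x∈p─q x∈t x∉s) empty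

⊆∧∣≥∣⇒≡ : s ⊆ t → ∣ t ∣ ≤ ∣ s ∣ → s ≡ t
⊆∧∣≥∣⇒≡ {s = s} {t = t} s⊆t t≤s = ⊆-antisym s⊆t λ {x} x∈t → case x ∈? s of λ
  { (yes x∈s) → x∈s
  ; (no  x∉s) → contradiction (p⊂q⇒∣p∣<∣q∣ (s⊆t , x , x∈t , x∉s)) (≤⇒≯ t≤s) }

⊆∧∣≡∣⇒≡ : s ⊆ t → ∣ s ∣ ≡ k → ∣ t ∣ ≡ k → s ≡ t
⊆∧∣≡∣⇒≡ s⊆t s≡k t≡k = ⊆∧∣≥∣⇒≡ s⊆t (≤-reflexive (trans t≡k (sym s≡k)))

⊆-codim1 : s ⊆ t → ∣ s ∣ ≡ k → ∣ t ∣ ≡ suc k → ∃ λ x → x ∈ t × x ∉ s × s ≡ t ∖ x × t ≡ s ⊕ x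
⊆-codim1 {s = s} {t = t} s⊆t s≡k t≡1+k
  with x , x∈t , x∉s ← ∣<∣⇒∃∉ {s = s} {t = t} (≤-reflexive (trans (cong suc s≡k) (sym t≡1+k)))
  with s≡ ← ⊆∧∣≡∣⇒≡ (⊆-∖ s⊆t x∉s) s≡k (∣∖∣′ x∈t t≡1+k)
  = x , x∈t , x∉s , s≡ , trans (sym (∖⊕ x∈t)) (cong (_⊕ x) (sym s≡))

∣∣>0⇒nonempty : 0 < ∣ t ∣ → ∃ λ x → x ∈ t
∣∣>0⇒nonempty {n} {t = t} 0<t with x , x∈t , _ ← ∣<∣⇒∃∉ {s = ⊥} {t = t} (subst (_< ∣ t ∣) (sym (∣⊥∣≡0 n)) 0<t) = x , x∈t

subset-of-size : ∀ {n k} → k ≤ n → ∃ λ (s : Subset n) → ∣ s ∣ ≡ k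
subset-of-size {n} {zero}  z≤n       = ⊥ , ∣⊥∣≡0 n
subset-of-size             (s≤s k≤n) with s , eq ← subset-of-size k≤n = inside ∷ s , cong suc eq

-- Enumeration of all subsets

allSubsets-complete : (s : Subset n) → s ∈ₗ allSubsets n
allSubsets-complete []          = here refl
allSubsets-complete (false ∷ s) = ∈-++⁺ˡ (∈-map⁺ (false ∷_) (allSubsets-complete s))
allSubsets-complete (true ∷ s)  = ∈-++⁺ʳ (map (false ∷_) (allSubsets _)) (∈-map⁺ (true ∷_) (allSubsets-complete s))

allSubsets-unique : ∀ n → Unique (allSubsets n)
allSubsets-unique zero    = All.[] AllPairs.∷ AllPairs.[]
allSubsets-unique (suc n) = ++⁺ (map⁺ Vec.∷-injectiveʳ (allSubsets-unique n))
                                (map⁺ Vec.∷-injectiveʳ (allSubsets-unique n))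
                                λ (p , q) → disjoint (∈-map⁻ _ p) (∈-map⁻ _ q)
  where
  disjoint : ∀ {s : Subset (suc n)} → (∃ λ t → t ∈ₗ allSubsets n × s ≡ false ∷ t) →
             ¬ (∃ λ t → t ∈ₗ allSubsets n × s ≡ true ∷ t)
  disjoint (_ , _ , refl) (_ , _ , ())

-- Pigeonhole principles between lists and subsets

module _ {A : Set a} {F : A → Fin n → Set p} (F-injective : ∀ {u w t} → F u t → F w t → u ≡ w) where

  private
    shrink : ∀ {u us t T} → Unique (u ∷ us) → F u t → (∀ {w} → w ∈ₗ u ∷ us → ∃ λ t → t ∈ T × F w t) →
             ∀ {w} → w ∈ₗ us → ∃ λ t′ → t′ ∈ T ∖ t × F w t′
    shrink uq Fut total w∈us with t′ , t′∈T , Fwt′ ← total (there w∈us) =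
      t′ , ∈-∖ t′∈T (λ { refl → Unique[x∷xs]⇒x∉xs uq (subst (_∈ₗ _) (F-injective Fwt′ Fut) w∈us) }) , Fwt′

  -- Induction on the list, deleting from `T` the partner of the head. A relation `F` replaces a
  -- function because the partner of `u` may depend on the proof that `u` lies in the list.
  injection-length : ∀ {us T} → Unique us → (∀ {u} → u ∈ₗ us → ∃ λ t → t ∈ T × F u t) → length us ≤ ∣ T ∣
  injection-length {us = []}     uq total = z≤n
  injection-length {us = u ∷ us} {T} uq total with t , t∈T , Fut ← total (here refl) =
    ≤-trans (s≤s (injection-length (AllPairs.tail uq) (shrink uq Fut total))) (≤-reflexive (∣∖∣ t∈T))

  -- Removing matched pairs one at a time keeps `∣ T ∣ ≤ length us`, so an unmatched `t` would
  -- survive until the list is empty.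
  injection-surjective : ∀ {us T} → Unique us → (∀ {u} → u ∈ₗ us → ∃ λ t → t ∈ T × F u t) → ∣ T ∣ ≤ length us →
                         ∀ {t} → t ∈ T → ∃ λ u → u ∈ₗ us × F u t
  injection-surjective {us = []} uq total T≤ t∈T = contradiction (≤-trans (≤-reflexive (∣∖∣ t∈T)) T≤) λ ()
  injection-surjective {us = u ∷ us} {T} uq total T≤ {t} t∈T with t₀ , t₀∈T , Fut₀ ← total (here refl) with t Fin.≟ t₀
  ... | yes refl = u , here refl , Fut₀
  ... | no t≢t₀
    with w , w∈us , Fwt ← injection-surjective (AllPairs.tail uq) (shrink uq Fut₀ total)
                            (s≤s⁻¹ (≤-trans (≤-reflexive (∣∖∣ t₀∈T)) T≤)) (∈-∖ t∈T t≢t₀)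
    = w , there w∈us , Fwt

surjection-length : ∀ {A : Set a} (_≟ₐ_ : DecidableEquality A) (g : Fin n → A) (us : List A) (T : Subset n) →
  (∀ {t t′} → t ∈ T → t′ ∈ T → g t ≡ g t′ → t ≡ t′) → (∀ {t} → t ∈ T → g t ∈ₗ us) → ∣ T ∣ ≤ length us
surjection-length {n = n} _≟ₐ_ g [] T inj into with nonempty? T
... | yes (t , t∈T) = contradiction (into t∈T) λ ()
... | no  empty     = ≤-reflexive (trans (cong ∣_∣ (Empty-unique empty)) (∣⊥∣≡0 n))
surjection-length _≟ₐ_ g (u ∷ us) T inj into with Fin.any? (λ t → (t ∈? T) ×-dec (u ≟ₐ g t))
... | yes (t , t∈T , refl) = ≤-trans (≤-reflexive (sym (∣∖∣ t∈T))) (s≤s (surjection-length _≟ₐ_ g us (T ∖ t)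
        (λ p q → inj (∖⊆ p) (∖⊆ q)) into′))
  where
  into′ : ∀ {t′} → t′ ∈ T ∖ t → g t′ ∈ₗ us
  into′ t′∈ with into (∖⊆ t′∈)
  ... | here eq   = contradiction (inj (∖⊆ t′∈) t∈T eq) (∈-∖⇒≢ t′∈)
  ... | there g∈  = g∈
... | no  ¬any = m≤n⇒m≤1+n (surjection-length _≟ₐ_ g us T inj into′)
  where
  into′ : ∀ {t′} → t′ ∈ T → g t′ ∈ₗ us
  into′ t′∈ with into t′∈
  ... | here eq   = contradiction (_ , t′∈ , sym eq) ¬any
  ... | there g∈  = g∈

-- Sums over lists and double counting

sumOver : {A : Set a} → (A → ℕ) → List A → ℕ
sumOver f []       = 0
sumOver f (x ∷ xs) = f x + sumOver f xs

module _ {A : Set a} where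

  sumOver-+ : ∀ (f g : A → ℕ) xs → sumOver (λ x → f x + g x) xs ≡ sumOver f xs + sumOver g xs
  sumOver-+ f g []       = refl
  sumOver-+ f g (x ∷ xs) = begin
    f x + g x + sumOver (λ x → f x + g x) xs    ≡⟨ cong (f x + g x +_) (sumOver-+ f g xs) ⟩
    f x + g x + (sumOver f xs + sumOver g xs)   ≡⟨ +-assoc (f x) (g x) _ ⟩
    f x + (g x + (sumOver f xs + sumOver g xs)) ≡⟨ cong (f x +_) (sym (+-assoc (g x) _ _)) ⟩
    f x + (g x + sumOver f xs + sumOver g xs)   ≡⟨ cong (λ h → f x + (h + sumOver g xs)) (+-comm (g x) _) ⟩
    f x + (sumOver f xs + g x + sumOver g xs)   ≡⟨ cong (f x +_) (+-assoc (sumOver f xs) _ _) ⟩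
    f x + (sumOver f xs + (g x + sumOver g xs)) ≡⟨ sym (+-assoc (f x) _ _) ⟩
    f x + sumOver f xs + (g x + sumOver g xs)   ∎
    where open ≡-Reasoning

  sumOver-0 : ∀ (xs : List A) → sumOver (λ _ → 0) xs ≡ 0
  sumOver-0 []       = refl
  sumOver-0 (x ∷ xs) = sumOver-0 xs

  sumOver-cong : ∀ {f g : A → ℕ} xs → (∀ x → f x ≡ g x) → sumOver f xs ≡ sumOver g xs
  sumOver-cong []       eq = refl
  sumOver-cong (x ∷ xs) eq = cong₂ _+_ (eq x) (sumOver-cong xs eq)

  sumOver-≥ : ∀ {f : A → ℕ} c xs → (∀ {x} → x ∈ₗ xs → c ≤ f x) → c * length xs ≤ sumOver f xs
  sumOver-≥ c []       c≤ = ≤-reflexive (*-zeroʳ c)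
  sumOver-≥ c (x ∷ xs) c≤ = ≤-trans (≤-reflexive (*-suc c _)) (+-mono-≤ (c≤ (here refl)) (sumOver-≥ c xs (c≤ ∘ there)))

  sumOver-≤ : ∀ {f : A → ℕ} c xs → (∀ {x} → x ∈ₗ xs → f x ≤ c) → sumOver f xs ≤ c * length xs
  sumOver-≤ c []       ≤c = z≤n
  sumOver-≤ c (x ∷ xs) ≤c = ≤-trans (+-mono-≤ (≤c (here refl)) (sumOver-≤ c xs (≤c ∘ there))) (≤-reflexive (sym (*-suc c _)))

  -- A term below `c` could not be made up for by the others, each of which is at most `c`.
  sumOver-≤-tight : ∀ {f : A → ℕ} c xs → (∀ {x} → x ∈ₗ xs → f x ≤ c) → c * length xs ≤ sumOver f xs →
                    ∀ {x} → x ∈ₗ xs → f x ≡ c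
  sumOver-≤-tight {f} c (x ∷ xs) ≤c tight = λ
    { (here refl) → ≤-antisym (≤c (here refl)) (+-cancelʳ-≤ (c * length xs) c (f x)
                      (≤-trans tight′ (+-monoʳ-≤ (f x) (sumOver-≤ c xs (≤c ∘ there)))))
    ; (there x∈)  → sumOver-≤-tight c xs (≤c ∘ there)
                      (+-cancelˡ-≤ c _ _ (≤-trans tight′ (+-monoˡ-≤ _ (≤c (here refl))))) x∈ }
    where
    tight′ : c + c * length xs ≤ f x + sumOver f xs
    tight′ = ≤-trans (≤-reflexive (sym (*-suc c _))) tight

module DoubleCounting {X : Set a} {Y : Set b} {R : X → Y → Set p} (R? : ∀ x y → Dec (R x y)) where

  sumOver-swap : ∀ xs ys → sumOver (λ x → length (filter (R? x) ys)) xs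
                         ≡ sumOver (λ y → length (filter (flip R? y) xs)) ys
  sumOver-swap []       ys = sym (sumOver-0 ys)
  sumOver-swap (x ∷ xs) ys = begin
    length (filter (R? x) ys) + sumOver (λ x → length (filter (R? x) ys)) xs
      ≡⟨ cong₂ _+_ (single ys) (sumOver-swap xs ys) ⟩
    sumOver (λ y → length (filter (flip R? y) (x ∷ []))) ys + sumOver (λ y → length (filter (flip R? y) xs)) ys
      ≡⟨ sym (sumOver-+ _ _ ys) ⟩
    sumOver (λ y → length (filter (flip R? y) (x ∷ [])) + length (filter (flip R? y) xs)) ys
      ≡⟨ sumOver-cong ys (λ y → trans (sym (List.length-++ (filter (flip R? y) (x ∷ []))))
                                      (cong length (sym (List.filter-++ (flip R? y) (x ∷ []) xs)))) ⟩
    sumOver (λ y → length (filter (flip R? y) (x ∷ xs))) ys ∎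
    where
    open ≡-Reasoning
    -- Filtering the one-element list `x ∷ []` serves as the 0/1 indicator of `R x y`.
    single : ∀ ys → length (filter (R? x) ys) ≡ sumOver (λ y → length (filter (flip R? y) (x ∷ []))) ys
    single []       = refl
    single (y ∷ ys) with does (R? x y)
    ... | true  = cong suc (single ys)
    ... | false = single ys

  module _ {xs ys} c d (c≤ : ∀ {x} → x ∈ₗ xs → c ≤ length (filter (R? x) ys))
                       (≤d : ∀ {y} → y ∈ₗ ys → length (filter (flip R? y) xs) ≤ d) where

    double-count : c * length xs ≤ d * length ys
    double-count = ≤-trans (sumOver-≥ c xs c≤) (≤-trans (≤-reflexive (sumOver-swap xs ys)) (sumOver-≤ d ys ≤d))

    double-count-tight : d * length ys ≡ c * length xs → ∀ {y} → y ∈ₗ ys → length (filter (flip R? y) xs) ≡ d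
    double-count-tight eq = sumOver-≤-tight d ys ≤d
      (≤-trans (≤-reflexive eq) (≤-trans (sumOver-≥ c xs c≤) (≤-reflexive (sumOver-swap xs ys))))

-- Filters and the number of subsets of given size

module _ {A : Set a} {P : Pred A p} (P? : Decidable P) where

  length-filter-split : ∀ xs → length xs ≡ length (filter P? xs) + length (filter (¬? ∘ P?) xs)
  length-filter-split []       = refl
  length-filter-split (x ∷ xs) with does (P? x)
  ... | true  = cong suc (length-filter-split xs)
  ... | false = trans (cong suc (length-filter-split xs)) (sym (+-suc _ _))

  length-filter-map : ∀ {B : Set b} (f : B → A) xs → length (filter P? (map f xs)) ≡ length (filter (P? ∘ f) xs)
  length-filter-map f []       = refl
  length-filter-map f (x ∷ xs) with does (P? (f x))
  ... | true  = cong suc (length-filter-map f xs)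
  ... | false = length-filter-map f xs


length-filter-allSubsets : ∀ n {P : Pred (Subset (suc n)) p} (P? : Decidable P) →
  length (filter P? (allSubsets (suc n))) ≡
  length (filter (P? ∘ (false ∷_)) (allSubsets n)) + length (filter (P? ∘ (true ∷_)) (allSubsets n))
length-filter-allSubsets n P? = begin
  length (filter P? (outs ++ ins))               ≡⟨ cong length (List.filter-++ P? outs ins) ⟩
  length (filter P? outs ++ filter P? ins)       ≡⟨ List.length-++ (filter P? outs) ⟩
  length (filter P? outs) + length (filter P? ins)
    ≡⟨ cong₂ _+_ (length-filter-map P? (false ∷_) (allSubsets n)) (length-filter-map P? (true ∷_) (allSubsets n)) ⟩
  length (filter (P? ∘ (false ∷_)) (allSubsets n)) + length (filter (P? ∘ (true ∷_)) (allSubsets n)) ∎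
  where
  open ≡-Reasoning
  outs = map (false ∷_) (allSubsets n)
  ins  = map (true ∷_) (allSubsets n)

length-filter-≐ : ∀ {A : Set a} {P Q : Pred A p} (P? : Decidable P) (Q? : Decidable Q) (xs : List A) →
  (∀ x → P x → Q x) → (∀ x → Q x → P x) → length (filter P? xs) ≡ length (filter Q? xs)
length-filter-≐ P? Q? xs P⇒Q Q⇒P = cong length (List.filter-≐ P? Q? ((λ {x} → P⇒Q x) , (λ {x} → Q⇒P x)) xs)

length-filter-∅ : ∀ {A : Set a} {P : Pred A p} (P? : Decidable P) (xs : List A) → (∀ x → ¬ P x) → length (filter P? xs) ≡ 0
length-filter-∅ P? xs ¬P = cong length (List.filter-none P? (All.universal ¬P xs))

length-filter-filter : ∀ {A : Set a} {P Q R : Pred A p} (P? : Decidable P) (Q? : Decidable Q) (R? : Decidable R) xs →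
  (∀ x → P x → Q x → R x) → (∀ x → R x → P x × Q x) → length (filter Q? (filter P? xs)) ≡ length (filter R? xs)
length-filter-filter P? Q? R? []       ⇒R R⇒ = refl
length-filter-filter P? Q? R? (x ∷ xs) ⇒R R⇒ with ih ← length-filter-filter P? Q? R? xs ⇒R R⇒ | R? x
... | yes Rx with Px , Qx ← R⇒ x Rx rewrite List.filter-accept P? {xs = xs} Px | List.filter-accept Q? {xs = filter P? xs} Qx = cong suc ih
... | no ¬Rx with P? x
...   | no  _  = ih
...   | yes Px rewrite List.filter-reject Q? {xs = filter P? xs} (¬Rx ∘ ⇒R x Px) = ih

ofSize? : ∀ k (s : Subset n) → Dec (∣ s ∣ ≡ k)
ofSize? k s = ∣ s ∣ ≟ k

count-ofSize : ∀ n k → length (filter (ofSize? k) (allSubsets n)) ≡ n C k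
count-ofSize zero    zero    = refl
count-ofSize zero    (suc k) = refl
count-ofSize (suc n) zero    = trans (length-filter-allSubsets n (ofSize? 0))
  (cong₂ _+_ (count-ofSize n 0) (length-filter-∅ (ofSize? 0 ∘ (true ∷_)) (allSubsets n) λ _ ()))
count-ofSize (suc n) (suc k) = begin
  length (filter (ofSize? (suc k)) (allSubsets (suc n))) ≡⟨ length-filter-allSubsets n (ofSize? (suc k)) ⟩
  _ ≡⟨ cong₂ _+_ (count-ofSize n (suc k)) (trans
         (length-filter-≐ (ofSize? (suc k) ∘ (true ∷_)) (ofSize? k) (allSubsets n) (λ _ → suc-injective) (λ _ → cong suc))
         (count-ofSize n k)) ⟩
  n C suc k + n C k ≡⟨ +-comm (n C suc k) _ ⟩
  n C k + n C suc k ≡⟨ nCk+nC[k+1]≡[n+1]C[k+1] n k ⟩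
  suc n C suc k ∎
  where open ≡-Reasoning

-- Subsets of given size through a vertex

Through : Fin n → ℕ → Subset n → Set
Through v k s = v ∈ s × ∣ s ∣ ≡ k

through? : ∀ (v : Fin n) k → Decidable (Through v k)
through? v k s = (v ∈? s) ×-dec (∣ s ∣ ≟ k)

count-through : ∀ {n} (v : Fin (suc n)) k → length (filter (through? v (suc k)) (allSubsets (suc n))) ≡ n C k
count-through {n} zero k = trans (length-filter-allSubsets n (through? zero (suc k)))
  (cong₂ _+_ (length-filter-∅ (through? zero (suc k) ∘ (false ∷_)) (allSubsets n) λ { _ (() , _) })
    (trans (length-filter-≐ (through? zero (suc k) ∘ (true ∷_)) (ofSize? k) (allSubsets n)
             (λ _ → suc-injective ∘ proj₂) (λ _ eq → Vec.here , cong suc eq))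
           (count-ofSize n k)))
count-through {suc n} (suc v) k = begin
  length (filter (through? (suc v) (suc k)) (allSubsets (2 + n))) ≡⟨ length-filter-allSubsets (suc n) (through? (suc v) (suc k)) ⟩
  _ ≡⟨ cong₂ _+_ (trans (length-filter-≐ (through? (suc v) (suc k) ∘ (false ∷_)) (through? v (suc k)) (allSubsets (suc n))
                          (λ { _ (Vec.there v∈ , eq) → v∈ , eq }) (λ { _ (v∈ , eq) → Vec.there v∈ , eq }))
                        (count-through v k))
                 (length-filter-≐ (through? (suc v) (suc k) ∘ (true ∷_)) (through? v k) (allSubsets (suc n))
                          (λ { _ (Vec.there v∈ , eq) → v∈ , suc-injective eq }) (λ { _ (v∈ , eq) → Vec.there v∈ , cong suc eq })) ⟩
  n C k + length (filter (through? v k) (allSubsets (suc n))) ≡⟨ pascal k ⟩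
  suc n C k ∎
  where
  open ≡-Reasoning
  -- The case `k = 0` stands apart because `count-through` counts sets of positive size; no empty
  -- set contains `v`.
  pascal : ∀ k → n C k + length (filter (through? v k) (allSubsets (suc n))) ≡ suc n C k
  pascal zero    = cong (n C 0 +_) (length-filter-∅ (through? v 0) (allSubsets (suc n))
                     λ { s (v∈s , s≡0) → contradiction (trans (∣∖∣ v∈s) s≡0) λ () })
  pascal (suc k) = trans (cong (n C suc k +_) (count-through v k))
                     (trans (+-comm (n C suc k) _) (nCk+nC[k+1]≡[n+1]C[k+1] n k))

-- Images of subsets under bijections

∣∣≡sum : (s : Subset n) → ∣ s ∣ ≡ sum (λ i → if lookup s i then 1 else 0)
∣∣≡sum []          = refl
∣∣≡sum (true  ∷ s) = cong suc (∣∣≡sum s)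
∣∣≡sum (false ∷ s) = ∣∣≡sum s

module _ {m n} (π : Fin m ↔ Fin n) where

  -- Writing the size as a sum of 0/1 indicators turns invariance into the reindexing of a finite
  -- sum by `π`.
  ∣image∣ : ∀ s → ∣ image π s ∣ ≡ ∣ s ∣
  ∣image∣ s = begin
    ∣ image π s ∣
      ≡⟨ ∣∣≡sum (image π s) ⟩
    sum (λ j → if lookup (image π s) j then 1 else 0)
      ≡⟨ sum-cong-≗ {n} (λ j → cong (if_then 1 else 0) (Vec.lookup∘tabulate (λ j → lookup s (Inverse.from π j)) j)) ⟩
    sum (λ j → if lookup s (Inverse.from π j) then 1 else 0)
      ≡⟨ sym (sum-permute (λ i → if lookup s i then 1 else 0) (Perm.flip π)) ⟩
    sum (λ i → if lookup s i then 1 else 0)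
      ≡⟨ sym (∣∣≡sum s) ⟩
    ∣ s ∣ ∎
    where open ≡-Reasoning

  image-inverse : ∀ s → image (Perm.flip π) (image π s) ≡ s
  image-inverse s = trans (Vec.tabulate-cong λ i → trans (Vec.lookup∘tabulate _ (Inverse.to π i))
                            (cong (lookup s) (Perm.inverseˡ π)))
                          (Vec.tabulate∘lookup s)

  ∈-image⁺ : ∀ {s j} → Inverse.from π j ∈ s → j ∈ image π s
  ∈-image⁺ {j = j} j∈ = Vec.lookup⇒[]= j _ (trans (Vec.lookup∘tabulate _ j) (Vec.[]=⇒lookup j∈))

  ∈-image⁻ : ∀ {s j} → j ∈ image π s → Inverse.from π j ∈ s
  ∈-image⁻ {s} {j} j∈ = Vec.lookup⇒[]= _ s (trans (sym (Vec.lookup∘tabulate _ j)) (Vec.[]=⇒lookup j∈))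

-- Friends and complete sets

module Friendship {q m} (H : Hypergraph (suc q) (suc m)) (friendship : IsFriendship H) where

  private
    r order : ℕ
    r = suc q
    order = suc m
    variable
      u v w : Fin order
      A A′ D e Q Q′ : Subset order
    E : Subset order → Set
    E = IsEdge H

  -- `Friend` quantifies over sets `B` of size r-1; taking `B = D ∖ u` recasts it in terms of r-sets
  -- `D` through `u`. The converse is `mkFriend`.
  friend-edge : Friend H u A → ∣ D ∣ ≡ r → u ∈ D → D ⊆ A ⊕ u → E D
  friend-edge {u} {D = D} (_ , edges) ∣D∣ u∈D D⊆ = subst E (trans (sym (⊕-def (D ∖ u) u)) (∖⊕ u∈D))
    (edges (D ∖ u) (λ y∈ → ∈⊕-≢ (D⊆ (∖⊆ y∈)) (∈-∖⇒≢ y∈)) (∣∖∣′ u∈D ∣D∣))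

  mkFriend : u ∉ A → (∀ {D} → ∣ D ∣ ≡ r → u ∈ D → D ⊆ A ⊕ u → E D) → Friend H u A
  mkFriend {u} u∉A edges = u∉A , λ B B⊆A ∣B∣ → subst E (⊕-def B u)
    (edges (trans (∣⊕∣ (u∉A ∘ B⊆A)) (cong suc ∣B∣)) ∈-⊕ (⊕-⊆ (⊆-⊕ ∘ B⊆A) ∈-⊕))

  opaque
    -- Junk value `zero` on sets of size other than r.
    friend : Subset order → Fin order
    friend A with ∣ A ∣ ≟ r
    ... | yes ∣A∣ = proj₁ (friendship A ∣A∣)
    ... | no  _   = zero

    friend-isFriend : ∣ A ∣ ≡ r → Friend H (friend A) A
    friend-isFriend {A} ∣A∣ with ∣ A ∣ ≟ r
    ... | yes ∣A∣′ = proj₁ (proj₂ (friendship A ∣A∣′))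
    ... | no  ≢r   = contradiction ∣A∣ ≢r

    friend-unique : ∣ A ∣ ≡ r → Friend H u A → u ≡ friend A
    friend-unique {A} ∣A∣ isFriend with ∣ A ∣ ≟ r
    ... | yes ∣A∣′ = proj₂ (proj₂ (friendship A ∣A∣′)) _ isFriend
    ... | no  ≢r   = contradiction ∣A∣ ≢r

  Complete : Subset order → Set
  Complete Q = ∣ Q ∣ ≡ suc r × (∀ {D} → ∣ D ∣ ≡ r → D ⊆ Q → E D)

  -- An r-subset of `e ⊕ friend e` either contains the friend, and is an edge by friendship, or is
  -- `e` itself.
  edge⇒complete : E e → Complete (e ⊕ friend e)
  edge⇒complete {e} Ee = trans (∣⊕∣ (proj₁ isFriend)) (cong suc ∣e∣) , edges
    where
    ∣e∣ = uniform H e Ee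
    isFriend : Friend H (friend e) e
    isFriend = friend-isFriend ∣e∣
    edges : ∀ {D} → ∣ D ∣ ≡ r → D ⊆ e ⊕ friend e → E D
    edges {D} ∣D∣ D⊆ with friend e ∈? D
    ... | yes f∈D = friend-edge isFriend ∣D∣ f∈D D⊆
    ... | no  f∉D = subst E (sym (⊆∧∣≡∣⇒≡ (λ y∈D → ∈⊕-≢ (D⊆ y∈D) λ { refl → f∉D y∈D }) ∣D∣ ∣e∣)) Ee

  -- The vertex of `Q` outside `e` is a friend of `e`, since all r-subsets of `Q` are edges. Friends
  -- being unique, both sets equal `e ⊕ friend e`.
  complete-unique : Complete Q → Complete Q′ → ∣ e ∣ ≡ r → e ⊆ Q → e ⊆ Q′ → Q ≡ Q′
  complete-unique {e = e} cQ cQ′ ∣e∣ e⊆Q e⊆Q′ = trans (determined cQ e⊆Q) (sym (determined cQ′ e⊆Q′))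
    where
    determined : Complete Q → e ⊆ Q → Q ≡ e ⊕ friend e
    determined (∣Q∣ , edges) e⊆Q with ⊆-codim1 e⊆Q ∣e∣ ∣Q∣
    ... | x , x∈Q , x∉e , _ , Q≡e⊕x = trans Q≡e⊕x (cong (e ⊕_) (friend-unique ∣e∣
            (mkFriend x∉e λ ∣D∣ _ D⊆ → edges ∣D∣ (⊕-⊆ e⊆Q x∈Q ∘ D⊆))))

  -- A complete set and a vertex outside it

  module OutsideVertex (complete : Complete Q) (v∉Q : v ∉ Q) where

    private
      X : Subset order
      X = Q ⊕ v
      ∣Q∣ = proj₁ complete
      ∣X∣ : ∣ X ∣ ≡ suc (suc r)
      ∣X∣ = trans (∣⊕∣ v∉Q) (cong suc ∣Q∣)

    -- `Q` and `X ∖ x` share the r-set `Q ∖ x`, so if both were complete they would be equal,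
    -- although only the latter contains `v`.
    ¬complete-swap : x ∈ Q → ¬ Complete (X ∖ x)
    ¬complete-swap x∈Q complete′ = v∉Q (subst (_ ∈_)
      (sym (complete-unique complete complete′ (∣∖∣′ x∈Q ∣Q∣) ∖⊆
        (λ y∈ → ∈-∖ (⊆-⊕ (∖⊆ y∈)) (∈-∖⇒≢ y∈))))
      (∈-∖ ∈-⊕ λ { refl → v∉Q x∈Q }))

    ∣X∖∖∣ : x ∈ Q → w ∈ Q → w ≢ x → ∣ X ∖ x ∖ w ∣ ≡ r
    ∣X∖∖∣ x∈Q w∈Q w≢x = ∣∖∣′ (∈-∖ (⊆-⊕ w∈Q) w≢x) (∣∖∣′ (⊆-⊕ x∈Q) ∣X∣)

    misses-two : ∣ D ∣ ≡ r → D ⊆ X → x ∈ Q → w ∈ Q → w ≢ x → x ∉ D → w ∉ D → D ≡ X ∖ x ∖ w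
    misses-two ∣D∣ D⊆X x∈Q w∈Q w≢x x∉D w∉D = ⊆∧∣≡∣⇒≡ (⊆-∖ (⊆-∖ D⊆X x∉D) w∉D) ∣D∣ (∣X∖∖∣ x∈Q w∈Q w≢x)

    -- On the (r+2)-set X, join two vertices when deleting both leaves an edge. An arrow says that x is
    -- joined to every vertex of X except possibly friend A, where A = X ∖ x ∖ friend A.
    record Arrow (A : Subset order) (x : Fin order) : Set where
      constructor arrow
      field
        size     : ∣ A ∣ ≡ r
        within   : A ⊆ X
        source∈Q : x ∈ Q
        target∈Q : friend A ∈ Q
        distinct : friend A ≢ x
        source∉A : x ∉ A
        joined   : ∀ {D} → ∣ D ∣ ≡ r → D ⊆ X → x ∉ D → friend A ∈ D → E D

      target∉A : friend A ∉ A
      target∉A = proj₁ (friend-isFriend size)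

      A-determined : A ≡ X ∖ x ∖ friend A
      A-determined = misses-two size within source∈Q target∈Q distinct source∉A target∉A

      -- If this set were an edge, `X ∖ x` would be complete: its r-subsets containing `friend A`
      -- are edges by `joined`, and the only one without it is this set.
      not-joined : ¬ E (X ∖ x ∖ friend A)
      not-joined edge = ¬complete-swap source∈Q (∣∖∣′ (⊆-⊕ source∈Q) ∣X∣ , edges)
        where
        edges : ∀ {D} → ∣ D ∣ ≡ r → D ⊆ X ∖ x → E D
        edges {D} ∣D∣ D⊆ with friend A ∈? D
        ... | yes t∈D = joined ∣D∣ (∖⊆ ∘ D⊆) (λ x∈D → ∈-∖⇒≢ (D⊆ x∈D) refl) t∈D
        ... | no  t∉D = subst E (sym (misses-two ∣D∣ (∖⊆ ∘ D⊆) source∈Q target∈Q distinct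
                                  (λ x∈D → ∈-∖⇒≢ (D⊆ x∈D) refl) t∉D)) edge

    open Arrow

    -- Were the targets different, `X ∖ x ∖ friend A` would contain `friend A′`, so `joined` for
    -- `A′` would make it an edge, against `not-joined`.
    arrow-injective : Arrow A x → Arrow A′ x → A ≡ A′
    arrow-injective {A} {x} {A′} F F′ with friend A Fin.≟ friend A′
    ... | yes eq = trans (A-determined F) (trans (cong (X ∖ x ∖_) eq) (sym (A-determined F′)))
    ... | no  ≢t = contradiction
      (joined F′ (∣X∖∖∣ (source∈Q F) (target∈Q F) (distinct F)) (∖⊆ ∘ ∖⊆)
        (λ x∈ → ∈-∖⇒≢ (∖⊆ x∈) refl)
        (∈-∖ (∈-∖ (⊆-⊕ (target∈Q F′)) (distinct F′)) (≢t ∘ sym)))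
      (not-joined F)

    -- If `A′` points back to `x`, both sets are `X` without the same two vertices, hence equal, and
    -- `friend A′` would be its own source `friend A`. Otherwise `joined` for `A′` makes
    -- `X ∖ x ∖ friend A` an edge.
    target-not-source : Arrow A x → ¬ Arrow A′ (friend A)
    target-not-source {A} {x} {A′} F F′ with friend A′ Fin.≟ x
    ... | yes refl = distinct F′ (cong friend (trans (A-determined F′)
                       (trans (∖-comm) (sym (A-determined F)))))
    ... | no  ≢x   = not-joined F (joined F′ (∣X∖∖∣ (source∈Q F) (target∈Q F) (distinct F)) (∖⊆ ∘ ∖⊆)
                       (λ t∈ → ∈-∖⇒≢ t∈ refl)
                       (∈-∖ (∈-∖ (⊆-⊕ (target∈Q F′)) ≢x) (distinct F′)))

    module _ {As} (unique : Unique As) (total : ∀ {A} → A ∈ₗ As → ∃ (Arrow A)) where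

      private
        avoid : ∀ {A₀} → A₀ ∈ₗ As → A ∈ₗ As → ∃ λ x → x ∈ Q ∖ friend A₀ × Arrow A x
        avoid A₀∈ A∈ with x , F ← total A∈ | _ , F₀ ← total A₀∈ =
          x , ∈-∖ (source∈Q F) (λ { refl → target-not-source F₀ F }) , F

      -- The target of one fixed `A₀` is the source of no arrow, so the sources inject into the r
      -- vertices of `Q ∖ friend A₀`. The copy `As′` of the list allows splitting on whether it is
      -- empty.
      arrows-bounded : ∀ As′ → As′ ≡ As → length As ≤ r
      arrows-bounded []       refl = z≤n
      arrows-bounded (A₀ ∷ _) refl = ≤-trans (injection-length arrow-injective unique (avoid (here refl)))
        (≤-reflexive (∣∖∣′ (target∈Q (proj₂ (total (here refl)))) ∣Q∣))

      -- With r sets, the sources exhaust `Q ∖ c`. Hence every target is `c`, since a target is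
      -- never a source.
      all-arrows⇒centre : ∀ As′ → As′ ≡ As → length As ≡ r →
        ∃ λ w → w ∈ Q × (∀ {D} → ∣ D ∣ ≡ r → D ⊆ X → w ∈ D → E D)
      all-arrows⇒centre (A₀ ∷ _) refl len = c , c∈Q , edges
        where
        c = friend A₀
        c∈Q = target∈Q (proj₂ (total (here refl)))
        source : ∀ {x} → x ∈ Q → x ≢ c → ∃ λ A → Arrow A x
        source x∈Q x≢c with A , _ , F ← injection-surjective arrow-injective unique (avoid (here refl))
          (≤-reflexive (trans (∣∖∣′ c∈Q ∣Q∣) (sym len))) (∈-∖ x∈Q x≢c) = A , F
        edges : ∀ {D} → ∣ D ∣ ≡ r → D ⊆ X → c ∈ D → E D
        -- `D` has r elements and `Q` has r+1, so some `x` of `Q` is missing from `D`; the arrow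
        -- from `x` points to `c`, which lies in `D`.
        edges {D} ∣D∣ D⊆X c∈D with x , x∈Q , x∉D ← ∣<∣⇒∃∉ {s = D} {t = Q} (≤-reflexive (trans (cong suc ∣D∣) (sym ∣Q∣)))
          with A , F ← source x∈Q (λ { refl → x∉D c∈D }) with friend A Fin.≟ c
        ... | yes eq = joined F ∣D∣ D⊆X x∉D (subst (_∈ D) (sym eq) c∈D)
        ... | no  ≢c = contradiction (proj₂ (source (target∈Q F) ≢c)) (target-not-source F)

  -- Double counting at a fixed vertex

  edges : List (Subset order)
  edges = filter (λ s → T? (edge H s)) (allSubsets order)

  module FixedVertex (v : Fin order) where

    sets : List (Subset order)
    sets = filter (through? v r) (allSubsets order)

    shifted completion : Subset order → Subset order
    shifted A = A ∖ v ⊕ friend A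
    completion A = shifted A ⊕ friend (shifted A)

    module _ (through : Through v r A) where

      private
        v∈A = proj₁ through
        ∣A∣ = proj₂ through
        isFriend : Friend H (friend A) A
        isFriend = friend-isFriend ∣A∣

      ∣shifted∣ : ∣ shifted A ∣ ≡ r
      ∣shifted∣ = trans (∣⊕∣ (proj₁ isFriend ∘ ∖⊆)) (trans (∣∖∣ v∈A) ∣A∣)

      shifted-edge : E (shifted A)
      shifted-edge = friend-edge isFriend ∣shifted∣ ∈-⊕ (⊕-⊆ (⊆-⊕ ∘ ∖⊆) ∈-⊕)

      completion-complete : Complete (completion A)
      completion-complete = edge⇒complete shifted-edge

      ⊆completion⊕v : A ⊆ completion A ⊕ v
      ⊆completion⊕v {y} y∈A with y Fin.≟ v
      ... | yes refl = ∈-⊕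
      ... | no  y≢v  = ⊆-⊕ (⊆-⊕ (⊆-⊕ (∈-∖ y∈A y≢v)))

      -- Deleting any one of the r+1 vertices of the complete set leaves an edge, and the results
      -- differ pairwise.
      completion-edges : suc r ≤ length (filter (_⊆? completion A) edges)
      completion-edges = ≤-trans (≤-reflexive (sym (proj₁ completion-complete)))
        (surjection-length (Vec.≡-dec Bool._≟_) (completion A ∖_) _ (completion A) injective into)
        where
        injective : ∀ {x y} → x ∈ completion A → y ∈ completion A → completion A ∖ x ≡ completion A ∖ y → x ≡ y
        injective {x} {y} x∈ y∈ eq with x Fin.≟ y
        ... | yes x≡y = x≡y
        ... | no  x≢y = contradiction refl (∈-∖⇒≢ (subst (x ∈_) (sym eq) (∈-∖ x∈ x≢y)))
        into : ∀ {x} → x ∈ completion A → completion A ∖ x ∈ₗ filter (_⊆? completion A) edges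
        into x∈ = ∈-filter⁺ (_⊆? completion A) (∈-filter⁺ (λ s → T? (edge H s)) (allSubsets-complete _)
          (proj₂ completion-complete (∣∖∣′ x∈ (proj₁ completion-complete)) ∖⊆)) ∖⊆

    fibre : Subset order → List (Subset order)
    fibre e = filter (λ A → e ⊆? completion A) sets

    fibre-unique : ∀ e → Unique (fibre e)
    fibre-unique e = filter⁺ (λ A → e ⊆? completion A) (filter⁺ (through? v r) (allSubsets-unique order))

    module _ {e Q} (complete : Complete Q) (∣e∣ : ∣ e ∣ ≡ r) (e⊆Q : e ⊆ Q) where

      -- `completion A` and `Q` are complete sets sharing the r-set `e`.
      fibre⁻ : A ∈ₗ fibre e → Through v r A × completion A ≡ Q
      fibre⁻ {A} A∈ with A∈sets , e⊆ ← ∈-filter⁻ (λ A → e ⊆? completion A) A∈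
                    with _ , through ← ∈-filter⁻ (through? v r) {xs = allSubsets order} A∈sets =
        through , complete-unique (completion-complete through) complete ∣e∣ e⊆ e⊆Q

      module _ (v∉Q : v ∉ Q) where
        open OutsideVertex complete v∉Q

        -- `Q` arises from `A` by deleting `v`, then adding `f = friend A` and a last vertex `x`.
        -- Hence `A ⊕ f` is `Q ⊕ v` without `x`, and `joined` is the friendship of `f` with `A`.
        through⇒arrow : Through v r A → completion A ≡ Q → Arrow A (friend (shifted A))
        through⇒arrow {A} through@(v∈A , ∣A∣) eq = record
          { size     = ∣A∣
          ; within   = A⊆X
          ; source∈Q = x∈Q
          ; target∈Q = f∈Q
          ; distinct = f≢x
          ; source∉A = x∉A
          ; joined   = λ ∣D∣ D⊆X x∉D f∈D → friend-edge isFriend ∣D∣ f∈D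
                         (subst (_ ⊆_) (sym A⊕f≡) (⊆-∖ D⊆X x∉D))
          }
          where
          isFriend : Friend H (friend A) A
          isFriend = friend-isFriend ∣A∣
          A⊆X : A ⊆ Q ⊕ v
          A⊆X = subst (λ Q → A ⊆ Q ⊕ v) eq (⊆completion⊕v through)
          x∉shifted : friend (shifted A) ∉ shifted A
          x∉shifted = proj₁ (friend-isFriend (∣shifted∣ through))
          f≢x : friend A ≢ friend (shifted A)
          f≢x eq = x∉shifted (subst (_∈ shifted A) eq ∈-⊕)
          x∈Q : friend (shifted A) ∈ Q
          x∈Q = subst (_ ∈_) eq ∈-⊕
          f∈Q : friend A ∈ Q
          f∈Q = subst (_ ∈_) eq (⊆-⊕ ∈-⊕)
          x∉A : friend (shifted A) ∉ A
          x∉A x∈A = x∉shifted (⊆-⊕ (∈-∖ x∈A λ eq → v∉Q (subst (_∈ Q) eq x∈Q)))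
          A⊕f≡ : A ⊕ friend A ≡ Q ⊕ v ∖ friend (shifted A)
          A⊕f≡ = ⊆∧∣≡∣⇒≡ (⊆-∖ (⊕-⊆ A⊆X (⊆-⊕ f∈Q)) (∉-⊕ x∉A (f≢x ∘ sym)))
                   (trans (∣⊕∣ (proj₁ isFriend)) (cong suc ∣A∣))
                   (∣∖∣′ (⊆-⊕ x∈Q) (trans (∣⊕∣ v∉Q) (cong suc (proj₁ complete))))

        fibre⇒arrow : A ∈ₗ fibre e → ∃ (Arrow A)
        fibre⇒arrow A∈ with through , eq ← fibre⁻ A∈ = _ , through⇒arrow through eq

        tight-fibre⇒centre : length (fibre e) ≡ r → ∃ λ w → w ∈ Q × (∀ {D} → ∣ D ∣ ≡ r → D ⊆ Q ⊕ v → w ∈ D → E D)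
        tight-fibre⇒centre = all-arrows⇒centre (fibre-unique e) fibre⇒arrow (fibre e) refl

      fibre-bounded : length (fibre e) ≤ r
      fibre-bounded with v ∈? Q
      ... | no  v∉Q = OutsideVertex.arrows-bounded complete v∉Q (fibre-unique e) (fibre⇒arrow v∉Q) (fibre e) refl
      -- Adding `v` to `Q` changes nothing here, so `A` is an r-subset of `Q`; the vertex it misses
      -- differs from `v`, which leaves r choices.
      ... | yes v∈Q = ≤-trans (injection-length {F = λ A x → A ≡ Q ∖ x} (λ eq eq′ → trans eq (sym eq′)) (fibre-unique e) total)
                              (≤-reflexive (∣∖∣′ v∈Q (proj₁ complete)))
        where
        total : A ∈ₗ fibre e → ∃ λ x → x ∈ Q ∖ v × A ≡ Q ∖ x
        total {A} A∈ with through@(v∈A , ∣A∣) , eq ← fibre⁻ A∈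
          with x , x∈Q , x∉A , A≡ , _ ← ⊆-codim1
            (⊕-⊆ id v∈Q ∘ subst (λ Q → A ⊆ Q ⊕ v) eq (⊆completion⊕v through)) ∣A∣ (proj₁ complete) =
          x , ∈-∖ x∈Q (λ { refl → x∉A v∈A }) , A≡

    private
      open DoubleCounting (λ A e → e ⊆? completion A)
      lower : A ∈ₗ sets → suc r ≤ length (filter (_⊆? completion A) edges)
      lower A∈ = completion-edges (proj₂ (∈-filter⁻ (through? v r) {xs = allSubsets order} A∈))
      upper : e ∈ₗ edges → length (fibre e) ≤ r
      upper e∈ with _ , Ee ← ∈-filter⁻ (λ s → T? (edge H s)) {xs = allSubsets order} e∈ =
        fibre-bounded (edge⇒complete Ee) (uniform H _ Ee) ⊆-⊕

    edges-bound : suc r * (m C q) ≤ r * numEdges H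
    edges-bound = subst (λ c → suc r * c ≤ r * numEdges H) (count-through v q) (double-count (suc r) r lower upper)

    tight : r * numEdges H ≡ suc r * (m C q) → E e → length (fibre e) ≡ r
    tight eq Ee = double-count-tight (suc r) r lower upper
      (trans eq (cong (suc r *_) (sym (count-through v q))))
      (∈-filter⁺ (λ s → T? (edge H s)) (allSubsets-complete _) Ee)

  -- Centres of complete sets in the equality case

  CentreAt : Subset order → Fin order → Fin order → Set
  CentreAt Q v w = w ∈ Q × (∀ {D} → ∣ D ∣ ≡ r → D ⊆ Q ⊕ v → w ∈ D → E D)

  tight⇒centreAt : r * numEdges H ≡ suc r * (m C q) → Complete Q → v ∉ Q → ∃ (CentreAt Q v)
  tight⇒centreAt {Q} {v} eq complete@(∣Q∣ , edges) v∉Q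
    -- Any r-subset of the complete set `Q` serves as the edge whose fibre has size r.
    with x , x∈Q ← ∣∣>0⇒nonempty {t = Q} (subst (0 <_) (sym ∣Q∣) (s≤s z≤n)) =
    tight-fibre⇒centre complete (∣∖∣′ x∈Q ∣Q∣) ∖⊆ v∉Q (tight eq (edges (∣∖∣′ x∈Q ∣Q∣) ∖⊆))
    where open FixedVertex v

  centre-friend : CentreAt Q v w → D ⊆ Q ⊕ v → w ∉ D → Friend H w D
  centre-friend (w∈Q , edges) D⊆ w∉D = mkFriend w∉D λ ∣D∣ w∈ D′⊆ →
    edges ∣D∣ (⊕-⊆ D⊆ (⊆-⊕ w∈Q) ∘ D′⊆) w∈

  -- If `D` were an edge, `D ⊕ w` would be complete. It shares the r-set `D ⊕ w ∖ v` with `Q`, so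
  -- the two would agree, but `v` is not in `Q`.
  centre-nonedge : Complete Q → v ∉ Q → CentreAt Q v w → ∣ D ∣ ≡ r → D ⊆ Q ⊕ v → v ∈ D → w ∉ D → ¬ E D
  centre-nonedge {Q} {v} {w} {D} complete v∉Q (w∈Q , edges) ∣D∣ D⊆ v∈D w∉D ED =
    v∉Q (subst (v ∈_) (sym Q≡D⊕w) (⊆-⊕ v∈D))
    where
    ∣D⊕w∣ : ∣ D ⊕ w ∣ ≡ suc r
    ∣D⊕w∣ = trans (∣⊕∣ w∉D) (cong suc ∣D∣)
    edges′ : ∀ {D′} → ∣ D′ ∣ ≡ r → D′ ⊆ D ⊕ w → E D′
    edges′ {D′} ∣D′∣ D′⊆ with w ∈? D′
    ... | yes w∈D′ = edges ∣D′∣ (⊕-⊆ D⊆ (⊆-⊕ w∈Q) ∘ D′⊆) w∈D′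
    ... | no  w∉D′ = subst E (sym (⊆∧∣≡∣⇒≡ (λ y∈ → ∈⊕-≢ (D′⊆ y∈) λ { refl → w∉D′ y∈ }) ∣D′∣ ∣D∣)) ED
    Q≡D⊕w : Q ≡ D ⊕ w
    Q≡D⊕w = complete-unique {e = D ⊕ w ∖ v} complete (∣D⊕w∣ , edges′) (∣∖∣′ (⊆-⊕ v∈D) ∣D⊕w∣)
      (λ y∈ → ∈⊕-≢ (⊕-⊆ D⊆ (⊆-⊕ w∈Q) (∖⊆ y∈)) (∈-∖⇒≢ y∈)) ∖⊆

  Centre : Subset order → Fin order → Set
  Centre Q w = w ∈ Q × (∀ {v} → v ∉ Q → ∀ {D} → ∣ D ∣ ≡ r → D ⊆ Q ⊕ v → w ∈ D → E D)

  Universal : Fin order → Set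
  Universal w = ∀ {D} → ∣ D ∣ ≡ r → w ∈ D → E D

  -- From centres to a universal vertex

  module Extremal (2≤q : 2 ≤ q) (centreAt : ∀ {Q v} → Complete Q → v ∉ Q → ∃ (CentreAt Q v)) where

    -- If `w ≢ w′`, delete `w′` and a third vertex `s` from `Q` to get `B`. Then `B ⊕ v` contains
    -- `w` and is an edge, while `B ⊕ v′` avoids `w′` and is not. The complete set `Q″` of the
    -- former turns out to contain `B ⊕ w′`, which forces it to be `Q` although it contains `v`.
    centre-independent : ∀ {v v′ w w′} → Complete Q → v ∉ Q → v′ ∉ Q → CentreAt Q v w → CentreAt Q v′ w′ → w ≡ w′
    centre-independent {Q} {v} {v′} {w} {w′} complete@(∣Q∣ , _) v∉Q v′∉Q c@(w∈Q , edges) c′@(w′∈Q , _) with w Fin.≟ w′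
    ... | yes w≡w′ = w≡w′
    ... | no  w≢w′
      with s , s∈ ← ∣∣>0⇒nonempty {t = Q ∖ w ∖ w′} (subst (0 <_)
             (sym (∣∖∣′ (∈-∖ w′∈Q (w≢w′ ∘ sym)) (∣∖∣′ w∈Q ∣Q∣))) (≤-trans (s≤s z≤n) 2≤q))
      = contradiction (subst (v ∈_) (sym Q≡Q″) (⊆-⊕ ∈-⊕)) v∉Q
      where
      B Q″ : Subset order
      B = Q ∖ w′ ∖ s
      Q″ = B ⊕ v ⊕ friend (B ⊕ v)
      ∣B∣ : ∣ B ∣ ≡ q
      ∣B∣ = ∣∖∣′ (∈-∖ (∖⊆ (∖⊆ s∈)) (∈-∖⇒≢ s∈)) (∣∖∣′ w′∈Q ∣Q∣)
      B⊆Q : B ⊆ Q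
      B⊆Q = ∖⊆ ∘ ∖⊆
      w′∉B : w′ ∉ B
      w′∉B w′∈ = ∈-∖⇒≢ (∖⊆ w′∈) refl
      ∣B⊕∣ : ∀ {y} → y ∉ B → ∣ B ⊕ y ∣ ≡ r
      ∣B⊕∣ y∉B = trans (∣⊕∣ y∉B) (cong suc ∣B∣)
      ∣Bv′∣ : ∣ B ⊕ v′ ∣ ≡ r
      ∣Bv′∣ = ∣B⊕∣ (v′∉Q ∘ B⊆Q)
      B⊆Q″ : B ⊆ Q″
      B⊆Q″ = ⊆-⊕ ∘ ⊆-⊕
      complete″ : Complete Q″
      complete″ = edge⇒complete (edges (∣B⊕∣ (v∉Q ∘ B⊆Q)) (⊕-⊆ (⊆-⊕ ∘ B⊆Q) ∈-⊕)
        (⊆-⊕ (∈-∖ (∈-∖ w∈Q w≢w′) λ { refl → ∈-∖⇒≢ (∖⊆ s∈) refl })))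
      w′∉Bv′ : w′ ∉ B ⊕ v′
      w′∉Bv′ = ∉-⊕ w′∉B λ { refl → v′∉Q w′∈Q }
      ¬EBv′ : ¬ E (B ⊕ v′)
      ¬EBv′ = centre-nonedge complete v′∉Q c′ ∣Bv′∣ (⊕-⊆ (⊆-⊕ ∘ B⊆Q) ∈-⊕) ∈-⊕ w′∉Bv′
      v′∉Q″ : v′ ∉ Q″
      v′∉Q″ v′∈Q″ = ¬EBv′ (proj₂ complete″ ∣Bv′∣ (⊕-⊆ B⊆Q″ v′∈Q″))
      -- The centre `w″` of `Q″` at `v′` lies outside the nonedge `B ⊕ v′`, hence is its friend; so
      -- is `w′`, and friends are unique.
      w′∈Q″ : w′ ∈ Q″
      w′∈Q″ with w″ , c″@(w″∈Q″ , edges″) ← centreAt complete″ v′∉Q″ =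
        subst (_∈ Q″) (trans (friend-unique ∣Bv′∣ (centre-friend c″ Bv′⊆ (¬EBv′ ∘ edges″ ∣Bv′∣ Bv′⊆)))
                         (sym (friend-unique ∣Bv′∣ (centre-friend c′ (⊕-⊆ (⊆-⊕ ∘ B⊆Q) ∈-⊕) w′∉Bv′)))) w″∈Q″
        where
        Bv′⊆ : B ⊕ v′ ⊆ Q″ ⊕ v′
        Bv′⊆ = ⊕-⊆ (⊆-⊕ ∘ B⊆Q″) ∈-⊕
      Q≡Q″ : Q ≡ Q″
      Q≡Q″ = complete-unique complete complete″ (∣B⊕∣ w′∉B) (⊕-⊆ B⊆Q w′∈Q) (⊕-⊆ B⊆Q″ w′∈Q″)

    centre-exists : Complete Q → ∃ (Centre Q)
    centre-exists {Q} complete@(∣Q∣ , _) with Fin.any? (λ v → ¬? (v ∈? Q))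
    ... | yes (v , v∉Q) with w , c@(w∈Q , _) ← centreAt complete v∉Q = w , w∈Q , edges′
      where
      edges′ : ∀ {v′} → v′ ∉ Q → ∀ {D} → ∣ D ∣ ≡ r → D ⊆ Q ⊕ v′ → w ∈ D → E D
      edges′ v′∉Q {D} ∣D∣ D⊆ w∈D with w′ , c′@(_ , edges) ← centreAt complete v′∉Q =
        edges ∣D∣ D⊆ (subst (_∈ D) (centre-independent complete v∉Q v′∉Q c c′) w∈D)
    -- Here `Q` is the whole vertex set, and being a centre asks only for membership.
    ... | no  ¬any with x , x∈Q ← ∣∣>0⇒nonempty {t = Q} (subst (0 <_) (sym ∣Q∣) (s≤s z≤n)) =
      x , x∈Q , λ v∉Q → contradiction (_ , v∉Q) ¬any

    -- `A` is an edge by the centre property at `a`, and `Q₁ = A ⊕ friend A` is its complete set. If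
    -- the centre of `Q₁` were some other `w′`, take `x` in `Q` outside `A`: the set `D₀ = A ⊕ x`
    -- lies in both `Q ⊕ a` and `Q₁ ⊕ x`, and the two centres disagree on whether some r-subset of
    -- it is an edge.
    centre-exchange : ∀ {A a w} → Complete Q → Centre Q w → ∣ A ∣ ≡ r → w ∈ A → a ∈ A → a ∉ Q → A ∖ a ⊆ Q →
                      ∃ λ Q′ → Complete Q′ × Centre Q′ w × A ⊆ Q′
    centre-exchange {Q} {A} {a} {w} complete@(∣Q∣ , _) (w∈Q , edges) ∣A∣ w∈A a∈A a∉Q A∖a⊆Q
      = Q₁ , complete′ , centre′ (centre-exists complete′) , ⊆-⊕
      where
      Q₁ : Subset order
      Q₁ = A ⊕ friend A
      A⊆Q⊕a : A ⊆ Q ⊕ a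
      A⊆Q⊕a = subst (_⊆ Q ⊕ a) (∖⊕ a∈A) (⊕-⊆ (⊆-⊕ ∘ A∖a⊆Q) ∈-⊕)
      complete′ : Complete Q₁
      complete′ = edge⇒complete (edges a∉Q ∣A∣ A⊆Q⊕a w∈A)
      w≢a : w ≢ a
      w≢a refl = a∉Q w∈Q
      centre′ : ∃ (Centre Q₁) → Centre Q₁ w
      centre′ (w′ , c′@(w′∈Q₁ , edges′)) with w Fin.≟ w′
      ... | yes refl = c′
      ... | no  w≢w′
        with x , x∈Q , x∉A ← ∣<∣⇒∃∉ {s = A} {t = Q} (≤-reflexive (trans (cong suc ∣A∣) (sym ∣Q∣)))
        -- A third vertex `b` of `A` exists because r is at least 3.
        with b , b∈ ← ∣∣>0⇒nonempty {t = A ∖ a ∖ w} (subst (0 <_)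
               (trans (cong (_∸ 1) (sym (∣∖∣′ a∈A ∣A∣))) (cong (_∸ 1) (sym (∣∖∣ (∈-∖ w∈A w≢a))))) (∸-monoˡ-≤ 1 2≤q))
        = ⊥-elim clash
        where
        D₀ : Subset order
        D₀ = A ⊕ x
        ∣D₀∣ : ∣ D₀ ∣ ≡ suc r
        ∣D₀∣ = trans (∣⊕∣ x∉A) (cong suc ∣A∣)
        D₀⊆Q⊕a : D₀ ⊆ Q ⊕ a
        D₀⊆Q⊕a = ⊕-⊆ A⊆Q⊕a (⊆-⊕ x∈Q)
        D₀⊆Q₁⊕x : D₀ ⊆ Q₁ ⊕ x
        D₀⊆Q₁⊕x = ⊕-⊆ (⊆-⊕ ∘ ⊆-⊕) ∈-⊕
        x∉Q₁ : x ∉ Q₁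
        x∉Q₁ x∈Q₁ = a∉Q (subst (a ∈_) (sym (complete-unique {e = D₀ ∖ a} complete complete′ (∣∖∣′ (⊆-⊕ a∈A) ∣D₀∣)
          (λ y∈ → ∈⊕-≢ (D₀⊆Q⊕a (∖⊆ y∈)) (∈-∖⇒≢ y∈)) (⊕-⊆ ⊆-⊕ x∈Q₁ ∘ ∖⊆))) (⊆-⊕ a∈A))
        clash : Empty.⊥
        clash with w′ ∈? D₀
        -- `D₀ ∖ w` contains `a` but not `w`, a nonedge for `Q`; it contains `w′`, an edge for `Q₁`.
        ... | yes w′∈D₀ = centre-nonedge complete a∉Q (w∈Q , edges a∉Q) ∣D∣ (D₀⊆Q⊕a ∘ ∖⊆)
                (∈-∖ (⊆-⊕ a∈A) (w≢a ∘ sym)) ∉-∖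
                (edges′ x∉Q₁ ∣D∣ (D₀⊆Q₁⊕x ∘ ∖⊆) (∈-∖ w′∈D₀ (w≢w′ ∘ sym)))
          where
          ∣D∣ : ∣ D₀ ∖ w ∣ ≡ r
          ∣D∣ = ∣∖∣′ (⊆-⊕ w∈A) ∣D₀∣
        -- `D₀ ∖ b` contains `x` but not `w′`, a nonedge for `Q₁`; it contains `w`, an edge for `Q`.
        ... | no w′∉D₀ = centre-nonedge complete′ x∉Q₁ (w′∈Q₁ , edges′ x∉Q₁) ∣D∣ (D₀⊆Q₁⊕x ∘ ∖⊆)
                (∈-∖ ∈-⊕ λ { refl → x∉A b∈A }) (w′∉D₀ ∘ ∖⊆)
                (edges a∉Q ∣D∣ (D₀⊆Q⊕a ∘ ∖⊆) (∈-∖ (⊆-⊕ w∈A) λ { refl → ∈-∖⇒≢ b∈ refl }))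
          where
          b∈A : b ∈ A
          b∈A = ∖⊆ (∖⊆ b∈)
          ∣D∣ : ∣ D₀ ∖ b ∣ ≡ r
          ∣D∣ = ∣∖∣′ (⊆-⊕ b∈A) ∣D₀∣

    -- Induction on a bound `k` for the number of vertices of `A` outside `Q₀`: swap one such `a`
    -- for some `x` in `Q₀`, reach the new set, then bring `a` back by `centre-exchange`. As `w`
    -- lies in `Q₀`, it is never swapped out.
    centre-reaches : ∀ {Q₀ w} → Complete Q₀ → Centre Q₀ w → ∀ k A → ∣ A ─ Q₀ ∣ ≤ k → ∣ A ∣ ≡ r → w ∈ A →
                     ∃ λ Q → Complete Q × Centre Q w × A ⊆ Q
    centre-reaches {Q₀} {w} complete₀@(∣Q₀∣ , _) c₀@(w∈Q₀ , _) k A ≤k ∣A∣ w∈A with nonempty? (A ─ Q₀)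
    ... | no  empty = Q₀ , complete₀ , c₀ , A⊆Q₀
      where
      A⊆Q₀ : A ⊆ Q₀
      A⊆Q₀ {y} y∈A with y ∈? Q₀
      ... | yes y∈Q₀ = y∈Q₀
      ... | no  y∉Q₀ = contradiction (y , x∈p∧x∉q⇒x∈p─q y∈A y∉Q₀) empty
    ... | yes (a , a∈) = step k ≤k
      where
      a∈A : a ∈ A
      a∈A = p─q⊆p A Q₀ a∈
      a∉Q₀ : a ∉ Q₀
      a∉Q₀ = ∈-─⇒∉ A Q₀ a∈
      shrinks : ∀ x → x ∈ Q₀ → A ∖ a ⊕ x ─ Q₀ ⊆ (A ─ Q₀) ∖ a
      shrinks x x∈Q₀ {y} y∈ with ∈-⊕⁻ (p─q⊆p (A ∖ a ⊕ x) Q₀ y∈)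
      ... | inj₁ y∈A∖a = ∈-∖ (x∈p∧x∉q⇒x∈p─q (∖⊆ y∈A∖a) (∈-─⇒∉ (A ∖ a ⊕ x) Q₀ y∈)) (∈-∖⇒≢ y∈A∖a)
      ... | inj₂ refl  = contradiction x∈Q₀ (∈-─⇒∉ (A ∖ a ⊕ x) Q₀ y∈)
      step : ∀ k → ∣ A ─ Q₀ ∣ ≤ k → ∃ λ Q → Complete Q × Centre Q w × A ⊆ Q
      step zero    ≤0   = contradiction (≤-trans (≤-reflexive (∣∖∣ a∈)) ≤0) λ ()
      step (suc k) ≤1+k
        with x , x∈Q₀ , x∉A ← ∣<∣⇒∃∉ {s = A} {t = Q₀} (≤-reflexive (trans (cong suc ∣A∣) (sym ∣Q₀∣)))
        with Q , complete , c , A′⊆Q ← centre-reaches complete₀ c₀ k (A ∖ a ⊕ x)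
               (s≤s⁻¹ (≤-trans (s≤s (p⊆q⇒∣p∣≤∣q∣ (shrinks x x∈Q₀))) (≤-trans (≤-reflexive (∣∖∣ a∈)) ≤1+k)))
               (trans (∣⊕∣ (x∉A ∘ ∖⊆)) (trans (∣∖∣ a∈A) ∣A∣))
               (⊆-⊕ (∈-∖ w∈A λ { refl → a∉Q₀ w∈Q₀ }))
        with a ∈? Q
      ... | no  a∉Q = centre-exchange complete c ∣A∣ w∈A a∈A a∉Q (A′⊆Q ∘ ⊆-⊕)
      ... | yes a∈Q = Q , complete , c , subst (_⊆ Q) (∖⊕ a∈A) (⊕-⊆ (A′⊆Q ∘ ⊆-⊕) a∈Q)

    -- A first complete set is the completion of an arbitrary r-set. Its centre stays a centre along
    -- exchanges, so every r-set through it is reached.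
    universal-exists : r ≤ order → ∃ Universal
    universal-exists r≤n
      with A , ∣A∣ ← subset-of-size r≤n
      with x , x∈A ← ∣∣>0⇒nonempty {t = A} (subst (0 <_) (sym ∣A∣) (s≤s z≤n))
      with complete ← FixedVertex.completion-complete x (x∈A , ∣A∣)
      with w , c ← centre-exists complete
      = w , λ {D} ∣D∣ w∈D → let Q , (_ , edges) , _ , D⊆Q = centre-reaches complete c ∣ D ─ _ ∣ D ≤-refl ∣D∣ w∈D in
            edges ∣D∣ D⊆Q

  -- Counting edges around a universal vertex

  module UniversalVertex {w} (universal : Universal w) where

    -- The vertex `x` of `e` outside `A ∖ w` is a friend of `A`: an r-set in `A ⊕ x` through `x`
    -- either contains `w`, and universality applies, or is `e`.
    edge-avoiding-universal : Through w r A → E e → w ∉ e → A ∖ w ⊆ e → e ≡ A ∖ w ⊕ friend A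
    edge-avoiding-universal {A} {e} (w∈A , ∣A∣) Ee w∉e A∖w⊆e
      with x , x∈e , x∉A∖w , _ , e≡ ← ⊆-codim1 A∖w⊆e (∣∖∣′ w∈A ∣A∣) (uniform H e Ee) =
      trans e≡ (cong (A ∖ w ⊕_) (friend-unique ∣A∣ (mkFriend x∉A edges′)))
      where
      x∉A : x ∉ A
      x∉A x∈A = x∉A∖w (∈-∖ x∈A λ { refl → w∉e x∈e })
      edges′ : ∀ {D} → ∣ D ∣ ≡ r → x ∈ D → D ⊆ A ⊕ x → E D
      edges′ {D} ∣D∣ _ D⊆ with w ∈? D
      ... | yes w∈D = universal ∣D∣ w∈D
      ... | no  w∉D = subst E (sym (⊆∧∣≡∣⇒≡ D⊆e ∣D∣ (uniform H e Ee))) Ee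
        where
        D⊆e : D ⊆ e
        D⊆e y∈D with ∈-⊕⁻ (D⊆ y∈D)
        ... | inj₁ y∈A  = A∖w⊆e (∈-∖ y∈A λ { refl → w∉D y∈D })
        ... | inj₂ refl = x∈e

    open FixedVertex w using (sets)

    private
      inner outer : List (Subset order)
      inner = filter (w ∈?_) edges
      outer = filter (¬? ∘ (w ∈?_)) edges

      inner-length : length inner ≡ m C q
      inner-length = trans (length-filter-filter (λ s → T? (edge H s)) (w ∈?_) (through? w r) (allSubsets order)
                             (λ s Es w∈s → w∈s , uniform H s Es) (λ s (w∈s , ∣s∣) → universal ∣s∣ w∈s , w∈s))
                           (count-through w q)

      outer⁻ : e ∈ₗ outer → E e × w ∉ e
      outer⁻ e∈ with e∈edges , w∉e ← ∈-filter⁻ (¬? ∘ (w ∈?_)) {xs = edges} e∈ =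
        proj₂ (∈-filter⁻ (λ s → T? (edge H s)) {xs = allSubsets order} e∈edges) , w∉e

      -- The (r-1)-sets avoiding `w` are represented by the r-sets `A` through `w`, with `A ∖ w ⊆ e`
      -- as incidence, so that `count-through` counts them.
      lower : e ∈ₗ outer → r ≤ length (filter (λ A → A ∖ w ⊆? e) sets)
      lower {e} e∈ with Ee , w∉e ← outer⁻ e∈ = ≤-trans (≤-reflexive (sym (uniform H e Ee)))
        (surjection-length (Vec.≡-dec Bool._≟_) (λ x → e ∖ x ⊕ w) _ e injective into)
        where
        injective : ∀ {x y} → x ∈ e → y ∈ e → e ∖ x ⊕ w ≡ e ∖ y ⊕ w → x ≡ y
        injective {x} {y} x∈e y∈e eq with x Fin.≟ y
        ... | yes x≡y = x≡y
        ... | no  x≢y with ∈-⊕⁻ (subst (x ∈_) (sym eq) (⊆-⊕ (∈-∖ x∈e x≢y)))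
        ...   | inj₁ x∈   = contradiction x∈ ∉-∖
        ...   | inj₂ refl = contradiction x∈e w∉e
        into : ∀ {x} → x ∈ e → e ∖ x ⊕ w ∈ₗ filter (λ A → A ∖ w ⊆? e) sets
        into x∈e = ∈-filter⁺ (λ A → A ∖ w ⊆? e) (∈-filter⁺ (through? w r) (allSubsets-complete _)
            (∈-⊕ , trans (∣⊕∣ (w∉e ∘ ∖⊆)) (trans (∣∖∣ x∈e) (uniform H e Ee))))
          (λ y∈ → ∖⊆ (∈⊕-≢ (∖⊆ y∈) (∈-∖⇒≢ y∈)))

      upper : A ∈ₗ sets → length (filter (λ e → A ∖ w ⊆? e) outer) ≤ 1
      upper {A} A∈ = ≤-trans (injection-length {F = λ e x → e ≡ A ∖ w ⊕ x} (λ eq eq′ → trans eq (sym eq′))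
          (filter⁺ (λ e → A ∖ w ⊆? e) (filter⁺ (¬? ∘ (w ∈?_)) (filter⁺ (λ s → T? (edge H s)) (allSubsets-unique order)))) total)
        (≤-reflexive (∣⁅x⁆∣≡1 (friend A)))
        where
        total : e ∈ₗ filter (λ e → A ∖ w ⊆? e) outer → ∃ λ x → x ∈ ⁅ friend A ⁆ × e ≡ A ∖ w ⊕ x
        total e∈ with e∈outer , A∖w⊆e ← ∈-filter⁻ (λ e → A ∖ w ⊆? e) {xs = outer} e∈
                 with Ee , w∉e ← outer⁻ e∈outer =
          friend A , x∈⁅x⁆ (friend A) ,
          edge-avoiding-universal (proj₂ (∈-filter⁻ (through? w r) {xs = allSubsets order} A∈)) Ee w∉e A∖w⊆e

    -- The `m C q` r-sets through `w` are all edges. Each edge avoiding `w` has r subsets of size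
    -- r-1, each in at most one such edge, so r times their number is at most `m C q`.
    edges-upper-bound : r * numEdges H ≤ suc r * (m C q)
    edges-upper-bound = begin
      r * numEdges H                    ≡⟨ cong (r *_) (length-filter-split (w ∈?_) edges) ⟩
      r * (length inner + length outer) ≡⟨ *-distribˡ-+ r (length inner) _ ⟩
      r * length inner + r * length outer
        ≤⟨ +-mono-≤ (≤-reflexive (cong (r *_) inner-length)) (DoubleCounting.double-count (λ e A → A ∖ w ⊆? e) r 1 lower upper) ⟩
      r * (m C q) + 1 * length sets     ≡⟨ cong (r * (m C q) +_) (trans (*-identityˡ _) (count-through w q)) ⟩
      r * (m C q) + m C q               ≡⟨ +-comm (r * (m C q)) _ ⟩
      suc r * (m C q)                   ∎
      where open ≤-Reasoning

    -- The Steiner system of the edges avoiding a universal vertex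

    private
      π : Permutation′ order
      π = transpose w zero

      -- `U-edge` keeps the new vertex at `zero`, so `w` is swapped with `zero`; `ι` identifies the
      -- subsets of the remaining m vertices with the sets avoiding `w`.
      ι : Subset m → Subset order
      ι t = image (Perm.flip π) (false ∷ t)

      w∉ι : ∀ t → w ∉ ι t
      w∉ι t w∈ with ∈-image⁻ (Perm.flip π) {s = false ∷ t} w∈
      ... | w∈′ with () ← subst (_∈ false ∷ t) (Perm.inverseʳ π {zero}) w∈′

      ι-surjective : w ∉ D → ∃ λ t → ι t ≡ D
      ι-surjective {D} w∉D with image π D in eq
      ... | false ∷ t = t , trans (cong (image (Perm.flip π)) (sym eq)) (image-inverse π D)
      ... | true  ∷ t = contradiction (∈-image⁻ π {s = D} (subst (zero ∈_) (sym eq) Vec.here)) w∉D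

      ι-injective : ∀ {t t′} → ι t ≡ ι t′ → t ≡ t′
      ι-injective {t} {t′} eq = Vec.∷-injectiveʳ (trans (sym (image-inverse (Perm.flip π) (false ∷ t)))
        (trans (cong (image π) eq) (image-inverse (Perm.flip π) (false ∷ t′))))

      ι-mono : ∀ {t t′} → t ⊆ t′ → ι t ⊆ ι t′
      ι-mono t⊆t′ y∈ = ∈-image⁺ (Perm.flip π) (out⊆ t⊆t′ (∈-image⁻ (Perm.flip π) y∈))

      ι-reflects : ∀ {t t′} → ι t ⊆ ι t′ → t ⊆ t′
      ι-reflects {t} {t′} ι⊆ {y} y∈t = drop-there (subst (_∈ false ∷ t′) inverse
        (∈-image⁻ (Perm.flip π) {j = Inverse.from π (suc y)} (ι⊆ (∈-image⁺ (Perm.flip π)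
          (subst (_∈ false ∷ t) (sym inverse) (Vec.there y∈t))))))
        where
        inverse : Inverse.to π (Inverse.from π (suc y)) ≡ suc y
        inverse = Perm.inverseʳ π

    steiner : Hypergraph r m
    steiner = record
      { edge    = λ t → edge H (ι t)
      ; uniform = λ t Et → trans (sym (∣image∣ (Perm.flip π) (false ∷ t))) (uniform H (ι t) Et)
      }

    -- The edge for `B` corresponds to `ι B` plus the friend of `ι B ⊕ w`; by
    -- `edge-avoiding-universal`, any edge avoiding `w` and containing `ι B` is that one.
    steiner-isSteiner : IsSteiner steiner
    steiner-isSteiner B ∣B∣ = let e , ιe≡ = ι-surjective w∉e₀ in
      e , (subst E (sym ιe≡) Ee₀ , ι-reflects (subst (ι B ⊆_) (sym ιe≡) ⊆-⊕)) ,
      λ e′ Ee′ B⊆e′ → ι-injective (trans (determined Ee′ (w∉ι e′) (ι-mono B⊆e′))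
                                    (sym (trans ιe≡ (determined Ee₀ w∉e₀ ⊆-⊕))))
      where
      A₀ : Subset order
      A₀ = ι B ⊕ w
      ∣ιB∣ : ∣ ι B ∣ ≡ q
      ∣ιB∣ = trans (∣image∣ (Perm.flip π) (false ∷ B)) ∣B∣
      ∣A₀∣ : ∣ A₀ ∣ ≡ r
      ∣A₀∣ = trans (∣⊕∣ (w∉ι B)) (cong suc ∣ιB∣)
      isFriend : Friend H (friend A₀) A₀
      isFriend = friend-isFriend ∣A₀∣
      w∉e₀ : w ∉ ι B ⊕ friend A₀
      w∉e₀ = ∉-⊕ (w∉ι B) λ eq → proj₁ isFriend (subst (_∈ A₀) eq ∈-⊕)
      Ee₀ : E (ι B ⊕ friend A₀)
      Ee₀ = friend-edge isFriend (trans (∣⊕∣ (proj₁ isFriend ∘ ⊆-⊕)) (cong suc ∣ιB∣)) ∈-⊕ (⊕-⊆ (⊆-⊕ ∘ ⊆-⊕) ∈-⊕)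
      determined : E e → w ∉ e → ι B ⊆ e → e ≡ A₀ ∖ w ⊕ friend A₀
      determined Ee w∉e ιB⊆e = edge-avoiding-universal (∈-⊕ , ∣A₀∣) Ee w∉e
        λ y∈ → ιB⊆e (∈⊕-≢ (∖⊆ y∈) (∈-∖⇒≢ y∈))

    universal-iso : IsoTo H (U-edge steiner)
    universal-iso = π , iso
      where
      iso : ∀ s → edge H s ≡ U-edge steiner (image π s)
      iso s with image π s in eq
      ... | false ∷ t = cong (edge H) (trans (sym (image-inverse π s)) (cong (image (Perm.flip π)) eq))
      -- A set through `w` is an edge exactly when it has r elements: universality gives one
      -- direction, uniformity the other.
      ... | true ∷ t with ∣s∣ ← trans (sym (∣image∣ π s)) (cong ∣_∣ eq) with ∣ t ∣ ≟ q
      ...   | yes ∣t∣ = T⇒≡true (universal (trans ∣s∣ (cong suc ∣t∣))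
                          (∈-image⁻ π {s = s} (subst (zero ∈_) (sym eq) Vec.here)))
        where
        T⇒≡true : ∀ {b} → T b → b ≡ true
        T⇒≡true {true} _ = refl
      ...   | no  ≢q = ¬T⇒≡false (λ Es → ≢q (suc-injective (trans (sym ∣s∣) (uniform H s Es))))
        where
        ¬T⇒≡false : ∀ {b} → ¬ T b → b ≡ false
        ¬T⇒≡false {true}  ¬T = contradiction _ ¬T
        ¬T⇒≡false {false} _  = refl

    isUniversal : IsUniversal H
    isUniversal = m , steiner , steiner-isSteiner , universal-iso , refl

  -- `U-edge` accepts every set of the right size through `zero`, so the vertex mapped to `zero` is
  -- universal.
  isUniversal⇒universal : IsUniversal H → ∃ Universal
  isUniversal⇒universal (_ , S , _ , (π , iso) , _) = Inverse.from π zero , λ {D} → universal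
    where
    universal : ∀ {D} → ∣ D ∣ ≡ r → Inverse.from π zero ∈ D → E D
    universal {D} ∣D∣ w∈D with image π D in eq
    ... | true ∷ t = subst T (sym (trans (iso D) (cong (U-edge S) eq)))
            (fromWitness (suc-injective (trans (trans (cong ∣_∣ (sym eq)) (∣image∣ π D)) ∣D∣)))
    ... | false ∷ t with () ← subst (zero ∈_) eq (∈-image⁺ π {s = D} w∈D)

-- The bound and its equality case

theorem1 : ∀ (r n : ℕ) → 3 ≤ r → r + 1 ≤ n → (H : Hypergraph r n) → IsFriendship H →
    ((r + 1) * ((n ∸ 1) C (r ∸ 1)) ≤ r * numEdges H)
    × (r * numEdges H ≡ (r + 1) * ((n ∸ 1) C (r ∸ 1)) ⇔ IsUniversal H)
theorem1 (suc q) zero    _          ()    H friendship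
-- The rewrite turns `r + 1` into `suc (suc q)`.
theorem1 (suc q) (suc m) (s≤s 2≤q) r+1≤n H friendship rewrite +-comm q 1 =
  edges-bound , mk⇔ tight⇒universal universal⇒tight
  where
  open Friendship H friendship
  -- The bound may be counted at any vertex; `zero` exists because n is positive.
  open FixedVertex zero using (edges-bound)

  tight⇒universal : suc q * numEdges H ≡ suc (suc q) * (m C q) → IsUniversal H
  tight⇒universal eq = UniversalVertex.isUniversal
    (proj₂ (Extremal.universal-exists 2≤q (tight⇒centreAt eq) (≤-trans (n≤1+n _) r+1≤n)))

  universal⇒tight : IsUniversal H → suc q * numEdges H ≡ suc (suc q) * (m C q)
  universal⇒tight isU = ≤-antisym
    (UniversalVertex.edges-upper-bound (proj₂ (isUniversal⇒universal isU))) edges-bound
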